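{- Let $G$ be a $k$-partite graph with color classes $V(G)=V_1\uplus\cdots\uplus V_k$, $|V_i|=q$ for all $i$, and let $Y$ and the partitions $R_{i,u}$ of $Y$ ($i\in[k]$, $u\in V_i$) be as defined in the context. Suppose that exactly one candidate $x_i\in V_i$ is selected from every color class. Then \[ \bigvee_{i=1}^k R_{i,x_i}=\mathbf 1_Y \] if and only if $\{x_1,\dots,x_k\}$ is not a clique of $G$.
   Context: Partitions of a finite set $W$ are ordered by refinement ($\pi\preceq\sigma$ iff every block of $\pi$ is contained in a block of $\sigma$); the join $\bigvee$ of a family is the finest partition coarser than all its members; $\mathbf 1_W=\{W\}$ is the one-block partition. For a graph $H$ on vertex set $W$ (isolated vertices allowed), $\mathrm{cc}(H)$ is the partition of $W$ into connected components of $H$. $[m]=\{1,\dots,m\}$. Construction (nonedge-conflict verifier). For every nonedge between distinct color classes, i.e. every pair $u\in V_i$, $v\in V_j$ with $i<j$ and $uv\notin E(G)$, create a vertex $z_{uv}$; let $Y=\{s,t\}\cup\{z_{uv}: u\in V_i,\ v\in V_j,\ i<j,\ uv\notin E(G)\}$, where $s,t$ are two further distinct points. For every $i\in[k]$ and $u\in V_i$ there is a graph $Q_{i,u}$ on $Y$; the edges of these graphs are exactly those given by the following rules, applied to each nonedge $uv$ with $u\in V_i$, $v\in V_j$, $i<j$: (1) add $sz_{uv}$ to $Q_{i,u}$; (2) add $z_{uv}t$ to $Q_{j,v}$; (3) for every $w\in V_j\setminus\{v\}$, add $sz_{uv}$ to $Q_{j,w}$. Put $R_{i,u}=\mathrm{cc}(Q_{i,u})$.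 -}

module Defs where

open import Data.Nat.Base using (ℕ)
open import Data.Fin.Base using (Fin; _<_)
open import Data.Product.Base using (Σ; ∃; ∃-syntax; _×_; _,_; proj₁; proj₂)
open import Data.Unit.Base using (⊤; tt)
open import Function.Bundles using (_↔_)
open import Level using (0ℓ)
open import Relation.Binary.Core using (Rel)
open import Relation.Binary.Definitions using (Symmetric; Irreflexive; Decidable)
open import Relation.Binary.Structures using (IsEquivalence)
open import Relation.Binary.PropositionalEquality using (_≡_; _≢_; refl)
open import Relation.Binary.Construct.Closure.ReflexiveTransitive
  using (Star; ε; _◅_; _◅◅_; reverse)
open import Relation.Binary.Construct.Closure.Symmetric
  using (SymClosure; fwd; bwd; symmetric)
open import Relation.Binary.Construct.Closure.Equivalence
  using (EqClosure; isEquivalence; return)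
open import Relation.Nullary.Negation using (¬_)
open import Relation.Unary using (Pred; _∈_; _⊆_; _≐_; _≬_; Satisfiable; U)

------------------------------------------------------------------------
-- Partitions

-- The set of blocks is the image of `block`. A block may be listed under
-- several indices, so two listed blocks are either disjoint or equal as
-- sets; this avoids having to choose a representative of each block.
record Partition (W : Set) : Set₁ where
  field
    Index    : Set
    block    : Index → Pred W 0ℓ
    nonempty : ∀ b → Satisfiable (block b)
    cover    : ∀ w → ∃[ b ] w ∈ block b
    disjoint : ∀ b c → block b ≬ block c → block b ≐ block c

open Partition public

infix 4 _⪯_ _≈_

_⪯_ : ∀ {W} → Rel (Partition W) 0ℓ
π ⪯ σ = ∀ b → ∃[ c ] block π b ⊆ block σ c

-- Equality of the sets of blocks.
_≈_ : ∀ {W} → Rel (Partition W) 0ℓ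
π ≈ σ = (∀ b → ∃[ c ] block π b ≐ block σ c)
      × (∀ c → ∃[ b ] block π b ≐ block σ c)

-- The element of W witnesses that the single block W is nonempty.
𝟏 : ∀ {W} → W → Partition W
𝟏 w₀ = record
  { Index    = ⊤
  ; block    = λ _ → U
  ; nonempty = λ _ → w₀ , tt
  ; cover    = λ _ → tt , tt
  ; disjoint = λ _ _ _ → (λ p → p) , (λ p → p)
  }

classes : ∀ {W} (_~_ : Rel W 0ℓ) → IsEquivalence _~_ → Partition W
classes {W} _~_ eq = record
  { Index    = W
  ; block    = _~_
  ; nonempty = λ w → w , E.refl
  ; cover    = λ w → w , E.refl
  ; disjoint = λ { a b (w , a~w , b~w) →
        (λ a~x → E.trans b~w (E.trans (E.sym a~w) a~x))
      , (λ b~x → E.trans a~w (E.trans (E.sym b~w) b~x)) }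
  }
  where module E = IsEquivalence eq

record IsJoin {W I : Set} (π : I → Partition W) (σ : Partition W) : Set₁ where
  field
    upper : ∀ i → π i ⪯ σ
    least : ∀ τ → (∀ i → π i ⪯ τ) → σ ⪯ τ

SameBlock : ∀ {W} → Partition W → Rel W 0ℓ
SameBlock π w w′ = ∃[ b ] (w ∈ block π b × w′ ∈ block π b)

-- `⋁-isJoin` shows that this is the finest partition coarser than all π i.
⋁ : ∀ {W I : Set} → (I → Partition W) → Partition W
⋁ π = classes (EqClosure (λ w w′ → ∃[ i ] SameBlock (π i) w w′))
              (isEquivalence _)

⋁-isJoin : ∀ {W I : Set} (π : I → Partition W) → IsJoin π (⋁ π)
⋁-isJoin {W} π = record { upper = upper ; least = least }
  where
  _~_ : Rel W 0ℓ
  w ~ w′ = ∃[ i ] SameBlock (π i) w w′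

  upper : ∀ i → π i ⪯ ⋁ π
  upper i b with nonempty (π i) b
  ... | w , w∈b = w , λ w′∈b → return (i , b , w∈b , w′∈b)

  least : ∀ τ → (∀ i → π i ⪯ τ) → ⋁ π ⪯ τ
  least τ π⪯τ w with cover τ w
  ... | d , w∈d = d , walk w∈d
    where
    step : ∀ {x y} → SymClosure _~_ x y → x ∈ block τ d → y ∈ block τ d
    step (fwd (i , b , x∈b , y∈b)) x∈d with π⪯τ i b
    ... | c , b⊆c = proj₁ (disjoint τ c d (_ , b⊆c x∈b , x∈d)) (b⊆c y∈b)
    step (bwd (i , b , y∈b , x∈b)) x∈d with π⪯τ i b
    ... | c , b⊆c = proj₁ (disjoint τ c d (_ , b⊆c x∈b , x∈d)) (b⊆c y∈b)

    walk : ∀ {x y} → x ∈ block τ d → EqClosure _~_ x y → y ∈ block τ d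
    walk x∈d ε        = x∈d
    walk x∈d (e ◅ es) = walk (step e x∈d) es

------------------------------------------------------------------------
-- Graphs

record Graph (W : Set) : Set₁ where
  field
    Adj    : Rel W 0ℓ
    sym    : Symmetric Adj
    irrefl : Irreflexive _≡_ Adj

cc : ∀ {W} → Graph W → Partition W
cc H = classes (Star Adj) record
  { refl  = ε
  ; sym   = reverse sym
  ; trans = _◅◅_
  }
  where open Graph H

IsClique : ∀ {W} → Graph W → Pred W 0ℓ → Set
IsClique H S = ∀ {u v} → u ∈ S → v ∈ S → u ≢ v → Graph.Adj H u v

-- The vertex set is the disjoint union of the colour classes V i.
-- Decidable adjacency is the constructive reading of "finite graph".
record PartiteGraph (k q : ℕ) : Set₁ where
  field
    V : Fin k → Set

  Vertex : Set
  Vertex = Σ (Fin k) V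

  field
    size    : ∀ i → V i ↔ Fin q
    graph   : Graph Vertex

  open Graph graph public using (Adj)

  field
    adj?    : Decidable Adj
    partite : ∀ {i} {u v : V i} → ¬ Adj (i , u) (i , v)

------------------------------------------------------------------------
-- The nonedge-conflict verifier

module Verifier {k q : ℕ} (G : PartiteGraph k q) where
  open PartiteGraph G

  -- The proof arguments are irrelevant, so that there is exactly one point
  -- z u v for each nonedge uv.
  data Y : Set where
    s t : Y
    z   : ∀ {i j} (u : V i) (v : V j) →
          .(i < j) → .(¬ Adj (i , u) (j , v)) → Y

  data QEdge : Vertex → Rel Y 0ℓ where
    rule₁ : ∀ {i j} {u : V i} {v : V j}
            .(i<j : i < j) .(uv∉E : ¬ Adj (i , u) (j , v)) →
            QEdge (i , u) s (z u v i<j uv∉E)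
    rule₂ : ∀ {i j} {u : V i} {v : V j}
            .(i<j : i < j) .(uv∉E : ¬ Adj (i , u) (j , v)) →
            QEdge (j , v) (z u v i<j uv∉E) t
    rule₃ : ∀ {i j} {u : V i} {v w : V j}
            .(i<j : i < j) .(uv∉E : ¬ Adj (i , u) (j , v)) → w ≢ v →
            QEdge (j , w) s (z u v i<j uv∉E)

  Q : ∀ i → V i → Graph Y
  Q i u = record
    { Adj    = SymClosure (QEdge (i , u))
    ; sym    = symmetric _
    ; irrefl = λ { refl (fwd ()) ; refl (bwd ()) }
    }

  R : ∀ i → V i → Partition Y
  R i u = cc (Q i u)

  Selected : (∀ i → V i) → Pred Vertex 0ℓ
  Selected x v = ∃[ i ] v ≡ (i , x i)

{-# OPTIONS --safe #-}
module Submission where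

open import Data.Empty using (⊥; ⊥-elim; ⊥-elim-irr)
open import Data.Fin.Base using (Fin; _<_)
open import Data.Fin.Properties using (any?; _<?_; <-cmp; <⇒≢) renaming (_≟_ to _≟ᶠ_)
open import Data.Nat.Base using (ℕ)
open import Data.Product.Base using (∃-syntax; _×_; _,_; proj₁)
open import Data.Unit.Base using (⊤; tt)
open import Function.Base using (_∘_)
open import Function.Bundles using (_⇔_; mk⇔; Equivalence)
open import Function.Properties.Inverse using (↔⇒↣)
open import Level using (0ℓ)
open import Relation.Binary.Construct.Closure.Equivalence using (isEquivalence; return)
open import Relation.Binary.Construct.Closure.ReflexiveTransitive using (Star; ε; _◅_; reverse)
open import Relation.Binary.Construct.Closure.Symmetric using (fwd; bwd)
open import Relation.Binary.Definitions using (DecidableEquality; tri<; tri≈; tri>)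
open import Relation.Binary.PropositionalEquality using (_≢_; refl; cong)
open import Relation.Binary.Structures using (IsEquivalence)
open import Relation.Nullary.Decidable using (Dec; yes; no; _×-dec_; ¬?; decidable-stable; via-injection)
open import Relation.Nullary.Negation using (¬_)
open import Relation.Unary using (Pred; _∈_)
open import Defs

-- If x i and x j (i < j) are nonadjacent, then s – z – t is a path through
-- z = z (x i) (x j), and every other point z u v is joined to t when v is the
-- selected vertex of its class and to s when it is not. If the selection is a
-- clique, then s together with the points z u v with v unselected is closed
-- under all edges of the selected graphs, and it misses t.

-- Turns equality with the one-block partition into reachability between points, the form in which
-- both directions of the theorem are argued. If some class is all of `W`, then any `x` and `y` are
-- both related to its representative, hence to each other.
classes≈𝟏⇔total : ∀ {W : Set} {_~_ : W → W → Set} (eq : IsEquivalence _~_) (w₀ : W) →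
  (classes _~_ eq ≈ 𝟏 w₀) ⇔ (∀ x y → x ~ y)
classes≈𝟏⇔total {_~_ = _~_} eq w₀ = mk⇔ to from
  where
  module E = IsEquivalence eq

  to : classes _~_ eq ≈ 𝟏 w₀ → ∀ x y → x ~ y
  to (_ , blocks) x y with blocks tt
  ... | _ , _ , U⊆b = E.trans (E.sym (U⊆b tt)) (U⊆b tt)

  from : (∀ x y → x ~ y) → classes _~_ eq ≈ 𝟏 w₀
  from total = (λ x → tt , (λ _ → tt) , λ _ → total x _)
             , (λ _ → w₀ , (λ _ → tt) , λ _ → total w₀ _)

module _ {W I : Set} (H : I → Graph W) where

  Joined : W → W → Set
  Joined = block (⋁ (cc ∘ H))

  joined-edge : ∀ i {x y} → Graph.Adj (H i) x y → Joined x y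
  joined-edge i {x} e = return (i , x , ε , e ◅ ε)

  -- Adjacency is symmetric, so a set closed under the edges of every `H i` is a union of components
  -- of each `H i`, and no chain of shared components can leave it.
  joined-invariant : (P : Pred W 0ℓ) →
    (∀ i {x y} → Graph.Adj (H i) x y → x ∈ P → y ∈ P) →
    ∀ {x y} → Joined x y → x ∈ P → y ∈ P
  joined-invariant P closed = walk
    where
    path : ∀ i {x y} → Star (Graph.Adj (H i)) x y → x ∈ P → y ∈ P
    path i ε        px = px
    path i (e ◅ es) px = path i es (closed i e px)

    back : ∀ i {x y} → Star (Graph.Adj (H i)) x y → y ∈ P → x ∈ P
    back i = path i ∘ reverse (Graph.sym (H i))

    walk : ∀ {x y} → Joined x y → x ∈ P → y ∈ P
    walk ε                             px = px
    -- A block is the component of its index `b`, so the route from `x` to `y` goes back to `b` and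
    -- then forward.
    walk (fwd (i , b , b~x , b~y) ◅ es) px = walk es (path i b~y (back i b~x px))
    walk (bwd (i , b , b~y , b~x) ◅ es) px = walk es (path i b~y (back i b~x px))

module _ {k q : ℕ} (G : PartiteGraph k q) (x : ∀ i → PartiteGraph.V G i) where
  open PartiteGraph G
  open Verifier G

  -- Transported from `Fin q` along the enumeration of the class; it decides whether `rule₂` or
  -- `rule₃` applies to a point `z u v`.
  _≟_ : ∀ {i} → DecidableEquality (V i)
  _≟_ {i} = via-injection (↔⇒↣ (size i)) _≟ᶠ_

  SelectedNonedge : Set
  SelectedNonedge = ∃[ i ] ∃[ j ] (i < j × ¬ Adj (i , x i) (j , x j))

  selectedNonedge? : Dec SelectedNonedge
  selectedNonedge? = any? λ i → any? λ j → i <? j ×-dec ¬? (adj? _ _)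

  noNonedge⇒clique : ¬ SelectedNonedge → IsClique graph (Selected x)
  noNonedge⇒clique none (i , refl) (j , refl) u≢v with <-cmp i j
  ... | tri< i<j _ _  = decidable-stable (adj? _ _) λ ¬e → none (i , j , i<j , ¬e)
  -- Each class contributes one selected vertex, so equal indices force equal vertices.
  ... | tri≈ _ refl _ = ⊥-elim (u≢v refl)
  ... | tri> _ _ j<i  = Graph.sym graph (decidable-stable (adj? _ _) λ ¬e → none (j , i , j<i , ¬e))

  selected : Fin k → Graph Y
  selected i = Q i (x i)

  _~_ : Y → Y → Set
  _~_ = Joined selected

  module E = IsEquivalence (isEquivalence (λ w w′ → ∃[ i ] SameBlock (R i (x i)) w w′))

  nonedge⇒connected : SelectedNonedge → ∀ y y′ → y ~ y′
  nonedge⇒connected (i , j , i<j , xᵢxⱼ∉E) y y′ = E.trans (E.sym (s~ y)) (s~ y′)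
    where
    s~t : s ~ t
    s~t = E.trans (joined-edge selected i (fwd (rule₁ i<j xᵢxⱼ∉E)))
                  (joined-edge selected j (fwd (rule₂ i<j xᵢxⱼ∉E)))

    s~ : ∀ y → s ~ y
    s~ s = E.refl
    s~ t = s~t
    s~ (z {j = b} u v a<b uv∉E) with x b ≟ v
    ... | yes refl = E.trans s~t (joined-edge selected b (bwd (rule₂ a<b uv∉E)))
    ... | no xb≢v  = joined-edge selected b (fwd (rule₃ a<b uv∉E xb≢v))

  OnSourceSide : Pred Y 0ℓ
  OnSourceSide s                   = ⊤
  OnSourceSide t                   = ⊥
  OnSourceSide (z {j = j} _ v _ _) = x j ≢ v

  connected⇒¬clique : s ~ t → ¬ IsClique graph (Selected x)
  connected⇒¬clique s~t clique = joined-invariant selected OnSourceSide closed s~t tt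
    where
    closed : ∀ i {y y′} → Graph.Adj (selected i) y y′ → OnSourceSide y → OnSourceSide y′
    -- Matching on `refl` supposes that `v` is the selected vertex of class `j`. The point then
    -- records a nonedge between two selected vertices, which the clique forbids.
    closed i (fwd (rule₁ {j = j} i<j uv∉E)) _ refl =
      ⊥-elim-irr (uv∉E (clique (i , refl) (j , refl) (<⇒≢ i<j ∘ cong proj₁)))
    -- The edge into `t` starts at a point whose `v` is the selected `x i`, so it starts outside the
    -- set.
    closed i (fwd (rule₂ _ _))      xᵢ≢xᵢ = xᵢ≢xᵢ refl
    closed i (fwd (rule₃ _ _ xᵢ≢v)) _     = xᵢ≢v
    closed i (bwd (rule₁ _ _))      _     = tt
    closed i (bwd (rule₂ _ _))      ()
    closed i (bwd (rule₃ _ _ _))    _     = tt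

lemma3p7 : ∀ (k q : ℕ) (G : PartiteGraph k q) (x : ∀ i → PartiteGraph.V G i) →
    (⋁ (λ i → Verifier.R G i (x i)) ≈ 𝟏 (Verifier.s {G = G}))
      ⇔ (¬ IsClique (PartiteGraph.graph G) (Verifier.Selected G x))
lemma3p7 k q G x = mk⇔
  (λ join≈𝟏 → connected⇒¬clique G x (Equivalence.to total join≈𝟏 _ _))
  -- Failure to be a clique gives only the double negation of a selected nonedge; the finite search
  -- `selectedNonedge?` extracts an actual pair.
  (λ ¬clique → Equivalence.from total (nonedge⇒connected G x
    (decidable-stable (selectedNonedge? G x) (λ none → ¬clique (noNonedge⇒clique G x none)))))
  where total = classes≈𝟏⇔total (isEquivalence _) Verifier.s
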